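{- Let $k\ge 3$. For $r\ge 1$, let $k_r(\lambda)$ be the characteristic polynomial of the $r\times r$ matrix $K_r$ whose $(p,q)$ entry is $\binom{k-2+q-p}{k-3}$ if $q\ge p$, $1$ if $q=p-1$, and $0$ if $q<p-1$; and let $k_0(\lambda)=1$. Then for all $r\ge 1$, $$k_{r}(\lambda) = \left(\binom{k-2}{k-3}-\lambda\right)k_{r-1}(\lambda) + \sum_{i=2}^{r}(-1)^{i+1}\binom{k+i-3}{k-3}k_{r-i}(\lambda).$$
   Context: The characteristic polynomial of an $r\times r$ matrix $K_r$ is $\det(K_r-\lambda I)$. Empty sums are $0$. -}

module Defs where

open import Algebra.Bundles using (RawRing)
import Algebra.Definitions.RawMonoid
import Algebra.Definitions.RawSemiring
open import Data.Bool.Base using (if_then_else_)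
open import Data.Fin.Base using (Fin; toℕ) renaming (zero to fzero; suc to fsuc)
import Data.Fin.Properties as Fin
open import Data.Integer.Base as ℤ using (ℤ; 0ℤ; 1ℤ)
open import Data.List.Base using (List; []; _∷_; map)
open import Data.Nat.Base as ℕ using (ℕ; zero; suc; _∸_)
import Data.Nat.Properties as ℕ
open import Data.Nat.Combinatorics using () renaming (_C_ to _choose_)
open import Data.Vec.Functional using (Vector; removeAt)
open import Level using (0ℓ)
open import Relation.Binary.PropositionalEquality.Core using (_≡_)
open import Relation.Nullary.Decidable.Core using (does)

Matrix : ∀ {a} → Set a → ℕ → ℕ → Set a
Matrix A m n = Vector (Vector A n) m

module LinearAlgebra {c ℓ} (R : RawRing c ℓ) where
  open RawRing R
  open Algebra.Definitions.RawSemiring rawSemiring using (_^_)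
  open Algebra.Definitions.RawMonoid +-rawMonoid using (sum)

  -- Inclusive at both ends; empty (hence 0#) when b < a.
  sumFromTo : ℕ → ℕ → (ℕ → Carrier) → Carrier
  sumFromTo a b f = sum {suc b ∸ a} (λ j → f (a ℕ.+ toℕ j))

  minor : ∀ {m n} → Fin (suc m) → Fin (suc n) →
          Matrix Carrier (suc m) (suc n) → Matrix Carrier m n
  minor i j A p = removeAt (removeAt A i p) j

  -- Cofactor expansion along the first row; the 0 × 0 determinant is 1#.
  det : ∀ {n} → Matrix Carrier n n → Carrier
  det {zero}  A = 1#
  det {suc n} A =
    sum λ j → (- 1#) ^ toℕ j * (A fzero j * det (minor fzero j A))

  identity : ∀ {n} → Matrix Carrier n n
  identity p q = if does (p Fin.≟ q) then 1# else 0#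

-- ℤ[λ], by coefficient lists with the constant term first.  Trailing zeros
-- are allowed, so equality of polynomials is _≈ₚ_ and not _≡_.

Poly : Set
Poly = List ℤ

coeff : Poly → ℕ → ℤ
coeff []      n       = 0ℤ
coeff (a ∷ f) zero    = a
coeff (a ∷ f) (suc n) = coeff f n

infix 4 _≈ₚ_
_≈ₚ_ : Poly → Poly → Set
f ≈ₚ g = ∀ n → coeff f n ≡ coeff g n

infixl 6 _+ₚ_
_+ₚ_ : Poly → Poly → Poly
[]      +ₚ g       = g
(a ∷ f) +ₚ []      = a ∷ f
(a ∷ f) +ₚ (b ∷ g) = (a ℤ.+ b) ∷ (f +ₚ g)

infixl 7 _*ₚ_
_*ₚ_ : Poly → Poly → Poly
[]      *ₚ g = []
(a ∷ f) *ₚ g = map (a ℤ.*_) g +ₚ (0ℤ ∷ f *ₚ g)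

infix 8 -ₚ_
-ₚ_ : Poly → Poly
-ₚ f = map (λ a → ℤ.- a) f

infixl 6 _-ₚ_
_-ₚ_ : Poly → Poly → Poly
f -ₚ g = f +ₚ -ₚ g

const : ℤ → Poly
const a = a ∷ []

-- The indeterminate λ.
X : Poly
X = 0ℤ ∷ 1ℤ ∷ []

ℤ[λ] : RawRing 0ℓ 0ℓ
ℤ[λ] = record
  { Carrier = Poly
  ; _≈_     = _≈ₚ_
  ; _+_     = _+ₚ_
  ; _*_     = _*ₚ_
  ; -_      = -ₚ_
  ; 0#      = []
  ; 1#      = const 1ℤ
  }

open LinearAlgebra ℤ[λ]

-- Normalised as det (A − λI), so the leading coefficient is (−1)ⁿ.
charPoly : ∀ {n} → Matrix ℤ n n → Poly
charPoly A = det λ p q → const (A p q) -ₚ X *ₚ identity p q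

-- Indices start at 0 here; the entries depend only on q − p, so they agree
-- with the 1-based description.  The subtractions never truncate for k ≥ 3,
-- as k ∸ 2 + (q ∸ p) is only used when p ≤ q.
K : ℕ → (r : ℕ) → Matrix ℤ r r
K k r i j =
  if does (p ℕ.≤? q) then ℤ.+ ((k ∸ 2 ℕ.+ (q ∸ p)) choose (k ∸ 3))
  else if does (p ℕ.≟ suc q) then 1ℤ
  else 0ℤ
  where
  p = toℕ i
  q = toℕ j

kPoly : ℕ → ℕ → Poly
kPoly k zero      = const 1ℤ
kPoly k r@(suc _) = charPoly (K k r)

{-# OPTIONS --safe #-}

-- Deleting row 0 and column j + 1 of a Toeplitz–Hessenberg matrix leaves a
-- matrix with first column (1, 0, …, 0), and deleting its first row and column
-- gives, by translation invariance, what deleting row 0 and column j leaves of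
-- the matrix of size one less.  By induction the minor at (0, j) of the
-- n + 1 square matrix is the determinant of size n − j, so that the expansion
-- along the first row is the recurrence.

module Submission where

open import Algebra.Bundles using (RawRing; Ring)
import Algebra.Properties.Semiring.Sum as SemiringSum
open import Algebra.Structures using (IsAbelianGroup; IsRing)
open import Defs
open import Data.Fin.Base as Fin using (Fin; toℕ; punchIn)
import Data.Integer.Base as ℤ
open import Data.Integer.Base using (ℤ; 0ℤ; 1ℤ)
open import Data.Integer.Base using (+_; -1ℤ; _*_; _^_)
import Data.Integer.Properties as ℤ
open import Data.Integer.Tactic.RingSolver using (solve-∀)
open import Data.List.Base using ([]; _∷_; map)
open import Data.Nat.Base using (zero; suc; s≤s; z≤n)
open import Data.Nat.Base using (ℕ; _+_; _∸_; _≤_)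
open import Data.Nat.Combinatorics using (_C_)
import Data.Nat.Properties as ℕ
open import Data.Product.Base using (_,_)
open import Level using (0ℓ)
open import Relation.Binary.PropositionalEquality
  using (_≡_; refl; sym; trans; cong; cong₂; module ≡-Reasoning)
import Relation.Binary.Reasoning.Setoid as SetoidReasoning
open LinearAlgebra ℤ[λ] using (sumFromTo)

-- Determinants of Toeplitz-Hessenberg matrices over a ring.

module Determinant {c ℓ} (R : Ring c ℓ) where
  open Ring R hiding (zero; sym)
    renaming (_+_ to _⊕_; _*_ to _⊗_; refl to ≈-refl; trans to ≈-trans)
  open LinearAlgebra rawRing
  open import Algebra.Definitions.RawSemiring (RawRing.rawSemiring rawRing)
    using () renaming (_^_ to _^ᴿ_)
  open SemiringSum semiring using (sum; sum-cong-≋; sum-replicate-zero)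
  open SetoidReasoning setoid

  laplaceTerm : ∀ {n} → Matrix Carrier (suc n) (suc n) → Fin (suc n) → Carrier
  laplaceTerm A j = (- 1#) ^ᴿ toℕ j ⊗ (A Fin.zero j ⊗ det (minor Fin.zero j A))

  det-cong : ∀ {n} (A B : Matrix Carrier n n) →
             (∀ p q → A p q ≈ B p q) → det A ≈ det B
  det-cong {zero}  A B A≈B = ≈-refl
  det-cong {suc n} A B A≈B = sum-cong-≋ {suc n} {laplaceTerm A} {laplaceTerm B} λ j →
    *-congˡ (*-cong (A≈B Fin.zero j)
      (det-cong (minor Fin.zero j A) (minor Fin.zero j B) λ p q → A≈B (Fin.suc p) (punchIn j q)))

  sum-zero : ∀ {n} (f : Fin n → Carrier) → (∀ j → f j ≈ 0#) → sum f ≈ 0#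
  sum-zero {n} f f≈0 =
    ≈-trans (sum-cong-≋ {n} {f} {λ _ → 0#} f≈0) (sum-replicate-zero n)

  laplaceTerm-zero : ∀ {n} (A : Matrix Carrier (suc n) (suc n)) j →
                  det (minor Fin.zero j A) ≈ 0# → laplaceTerm A j ≈ 0#
  laplaceTerm-zero A j minor≈0 =
    ≈-trans (*-congˡ (≈-trans (*-congˡ minor≈0) (zeroʳ _))) (zeroʳ _)

  -- Induction on the size: in the expansion along the first row, the term of column 0 has a zero
  -- entry as a factor, and every other minor still begins with a zero column.
  det-zeroColumn : ∀ {n} (A : Matrix Carrier (suc n) (suc n)) →
                   (∀ p → A p Fin.zero ≈ 0#) → det A ≈ 0#
  det-zeroColumn {n} A A≈0 = sum-zero (laplaceTerm A) (term n A A≈0)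
    where
    term : ∀ n (A : Matrix Carrier (suc n) (suc n)) →
           (∀ p → A p Fin.zero ≈ 0#) → ∀ j → laplaceTerm A j ≈ 0#
    term n A A≈0 Fin.zero =
      ≈-trans (*-congˡ (≈-trans (*-congʳ (A≈0 Fin.zero)) (zeroˡ _))) (zeroʳ _)
    term (suc n) A A≈0 (Fin.suc j) = laplaceTerm-zero A (Fin.suc j)
      (det-zeroColumn (minor Fin.zero (Fin.suc j) A) λ p → A≈0 (Fin.suc p))

  -- A minor that deletes a column other than the first keeps column 0 without its top entry. That
  -- column is zero, so only the term of column 0 survives in the expansion.
  det-unitColumn : ∀ {n} (A : Matrix Carrier (suc n) (suc n)) →
                   A Fin.zero Fin.zero ≈ 1# → (∀ p → A (Fin.suc p) Fin.zero ≈ 0#) →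
                   det A ≈ det (minor Fin.zero Fin.zero A)
  det-unitColumn {n} A A₀≈1 A₊≈0 = begin
    laplaceTerm A Fin.zero ⊕ sum (λ j → laplaceTerm A (Fin.suc j))
      ≈⟨ +-cong (≈-trans (*-identityˡ _) (≈-trans (*-congʳ A₀≈1) (*-identityˡ _)))
                (sum-zero (λ j → laplaceTerm A (Fin.suc j)) (term n A A₊≈0)) ⟩
    det (minor Fin.zero Fin.zero A) ⊕ 0#
      ≈⟨ +-identityʳ _ ⟩
    det (minor Fin.zero Fin.zero A) ∎
    where
    term : ∀ n (A : Matrix Carrier (suc n) (suc n)) →
           (∀ p → A (Fin.suc p) Fin.zero ≈ 0#) → ∀ j → laplaceTerm A (Fin.suc j) ≈ 0#
    term (suc n) A A₊≈0 j = laplaceTerm-zero A (Fin.suc j)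
      (det-zeroColumn (minor Fin.zero (Fin.suc j) A) A₊≈0)

  -- The condition is on a family of matrices, one of each size, so that deleting the first row and
  -- column of one member gives the preceding one. `subdiagonal` and `below` describe column 0 only;
  -- `translate` carries them to the other columns. The first row is left free.
  record IsToeplitzHessenberg (H : ∀ n → Matrix Carrier n n) : Set ℓ where
    field
      translate   : ∀ {n} p q → H (suc n) (Fin.suc p) (Fin.suc q) ≈ H n p q
      subdiagonal : ∀ {n} → H (suc (suc n)) (Fin.suc Fin.zero) Fin.zero ≈ 1#
      below       : ∀ {n} p → H (suc (suc n)) (Fin.suc (Fin.suc p)) Fin.zero ≈ 0#

  module _ {H : ∀ n → Matrix Carrier n n} (isTH : IsToeplitzHessenberg H) where
    open IsToeplitzHessenberg isTH

    minorOf : ∀ n → Fin (suc n) → Matrix Carrier n n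
    minorOf n j = minor Fin.zero j (H (suc n))

    det-minor : ∀ {n} (j : Fin (suc n)) → det (minorOf n j) ≈ det (H (n ∸ toℕ j))
    det-minor {n} Fin.zero = det-cong (minorOf n Fin.zero) (H n) translate
    det-minor {suc n} (Fin.suc j) = begin
      det (minorOf (suc n) (Fin.suc j))
        ≈⟨ det-unitColumn (minorOf (suc n) (Fin.suc j)) subdiagonal below ⟩
      det (minor Fin.zero Fin.zero (minorOf (suc n) (Fin.suc j)))
        -- `punchIn (suc j) (suc q)` computes to `suc (punchIn j q)`, so row and column index are
        -- both successors here and one use of `translate` lowers them together.
        ≈⟨ det-cong (minor Fin.zero Fin.zero (minorOf (suc n) (Fin.suc j))) (minorOf n j)
                    (λ p q → translate (Fin.suc p) (punchIn j q)) ⟩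
      det (minorOf n j)
        ≈⟨ det-minor j ⟩
      det (H (n ∸ toℕ j)) ∎

    det-recurrence : ∀ n → det (H (suc n)) ≈
      H (suc n) Fin.zero Fin.zero ⊗ det (H n) ⊕
      sum (λ j → (- 1#) ^ᴿ suc (toℕ j) ⊗ (H (suc n) Fin.zero (Fin.suc j) ⊗ det (H (n ∸ suc (toℕ j)))))
    det-recurrence n = +-cong
      (≈-trans (*-identityˡ _) (*-congˡ (det-minor {n} Fin.zero)))
      (sum-cong-≋ {n} {λ j → laplaceTerm (H (suc n)) (Fin.suc j)}
                      {λ j → (- 1#) ^ᴿ suc (toℕ j) ⊗ (H (suc n) Fin.zero (Fin.suc j) ⊗ det (H (n ∸ suc (toℕ j))))}
        λ j → *-congˡ (*-congˡ (det-minor (Fin.suc j))))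

-- The ring ℤ[λ] of coefficient lists.

coeff-+ₚ : ∀ f g n → coeff (f +ₚ g) n ≡ coeff f n ℤ.+ coeff g n
coeff-+ₚ []      g       n       = sym (ℤ.+-identityˡ _)
coeff-+ₚ (a ∷ f) []      n       = sym (ℤ.+-identityʳ _)
coeff-+ₚ (a ∷ f) (b ∷ g) zero    = refl
coeff-+ₚ (a ∷ f) (b ∷ g) (suc n) = coeff-+ₚ f g n

coeff-scale : ∀ a f n → coeff (map (a *_) f) n ≡ a * coeff f n
coeff-scale a []      n       = sym (ℤ.*-zeroʳ a)
coeff-scale a (b ∷ f) zero    = refl
coeff-scale a (b ∷ f) (suc n) = coeff-scale a f n

coeff-neg : ∀ f n → coeff (-ₚ f) n ≡ ℤ.- coeff f n
coeff-neg []      n       = refl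
coeff-neg (a ∷ f) zero    = refl
coeff-neg (a ∷ f) (suc n) = coeff-neg f n

-- This is (a + λf)g = ag + λ(fg) read off coefficientwise, the form in which the product laws below
-- are proved by induction on the left factor.
coeff-∷-* : ∀ a f g n →
            coeff ((a ∷ f) *ₚ g) n ≡ a * coeff g n ℤ.+ coeff (0ℤ ∷ f *ₚ g) n
coeff-∷-* a f g n =
  trans (coeff-+ₚ (map (a *_) g) _ n) (cong (ℤ._+ _) (coeff-scale a g n))

+ₚ-cong : ∀ f f′ g g′ → f ≈ₚ f′ → g ≈ₚ g′ → f +ₚ g ≈ₚ f′ +ₚ g′
+ₚ-cong f f′ g g′ f≈f′ g≈g′ n = begin
  coeff (f +ₚ g) n          ≡⟨ coeff-+ₚ f g n ⟩
  coeff f n ℤ.+ coeff g n   ≡⟨ cong₂ ℤ._+_ (f≈f′ n) (g≈g′ n) ⟩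
  coeff f′ n ℤ.+ coeff g′ n ≡⟨ coeff-+ₚ f′ g′ n ⟨
  coeff (f′ +ₚ g′) n        ∎
  where open ≡-Reasoning

-ₚ-cong : ∀ f g → f ≈ₚ g → -ₚ f ≈ₚ -ₚ g
-ₚ-cong f g f≈g n =
  trans (coeff-neg f n) (trans (cong (λ a → ℤ.- a) (f≈g n)) (sym (coeff-neg g n)))

+ₚ-comm : ∀ f g → f +ₚ g ≈ₚ g +ₚ f
+ₚ-comm f g n =
  trans (coeff-+ₚ f g n) (trans (ℤ.+-comm (coeff f n) _) (sym (coeff-+ₚ g f n)))

+ₚ-assoc : ∀ f g h → (f +ₚ g) +ₚ h ≈ₚ f +ₚ (g +ₚ h)
+ₚ-assoc f g h n = begin
  coeff ((f +ₚ g) +ₚ h) n                     ≡⟨ coeff-+ₚ (f +ₚ g) h n ⟩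
  coeff (f +ₚ g) n ℤ.+ coeff h n              ≡⟨ cong (ℤ._+ _) (coeff-+ₚ f g n) ⟩
  coeff f n ℤ.+ coeff g n ℤ.+ coeff h n       ≡⟨ ℤ.+-assoc (coeff f n) _ _ ⟩
  coeff f n ℤ.+ (coeff g n ℤ.+ coeff h n)     ≡⟨ cong (λ c → coeff f n ℤ.+ c) (coeff-+ₚ g h n) ⟨
  coeff f n ℤ.+ coeff (g +ₚ h) n              ≡⟨ coeff-+ₚ f (g +ₚ h) n ⟨
  coeff (f +ₚ (g +ₚ h)) n                     ∎
  where open ≡-Reasoning

+ₚ-inverseˡ : ∀ f → -ₚ f +ₚ f ≈ₚ []
+ₚ-inverseˡ f n = trans (coeff-+ₚ (-ₚ f) f n)
  (trans (cong (ℤ._+ coeff f n) (coeff-neg f n)) (ℤ.+-inverseˡ (coeff f n)))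

+ₚ-isAbelianGroup : IsAbelianGroup _≈ₚ_ _+ₚ_ [] (λ f → -ₚ f)
+ₚ-isAbelianGroup = record
  { isGroup = record
    { isMonoid = record
      { isSemigroup = record
        { isMagma = record
          { isEquivalence = record
            { refl  = λ n → refl
            ; sym   = λ f≈g n → sym (f≈g n)
            ; trans = λ f≈g g≈h n → trans (f≈g n) (g≈h n)
            }
          ; ∙-cong = λ {f} {f′} {g} {g′} → +ₚ-cong f f′ g g′
          }
        ; assoc = +ₚ-assoc
        }
      ; identity = (λ f n → refl) , (λ f → +ₚ-comm f [])
      }
    ; inverse = +ₚ-inverseˡ , λ f n → trans (+ₚ-comm f (-ₚ f) n) (+ₚ-inverseˡ f n)
    ; ⁻¹-cong = λ {f} {g} → -ₚ-cong f g
    }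
  ; comm = +ₚ-comm
  }

shift-cong : ∀ f g → f ≈ₚ g → 0ℤ ∷ f ≈ₚ 0ℤ ∷ g
shift-cong f g f≈g zero    = refl
shift-cong f g f≈g (suc n) = f≈g n

-- A list that represents 0 may be a nonempty list of zeros. Congruence of the product needs this
-- when one of two equal left factors is a shorter list than the other.
≈[]⇒*ₚ≈[] : ∀ f g → f ≈ₚ [] → f *ₚ g ≈ₚ []
≈[]⇒*ₚ≈[] []      g f≈[] n = refl
≈[]⇒*ₚ≈[] (a ∷ f) g f≈[] n = begin
  coeff ((a ∷ f) *ₚ g) n
    ≡⟨ coeff-∷-* a f g n ⟩
  a * coeff g n ℤ.+ coeff (0ℤ ∷ f *ₚ g) n
    ≡⟨ cong₂ (λ b c → b * coeff g n ℤ.+ c) (f≈[] 0) (tail n) ⟩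
  0ℤ * coeff g n ℤ.+ 0ℤ
    ≡⟨⟩
  0ℤ ∎
  where
  open ≡-Reasoning
  tail : 0ℤ ∷ f *ₚ g ≈ₚ []
  tail zero    = refl
  tail (suc n) = ≈[]⇒*ₚ≈[] f g (λ m → f≈[] (suc m)) n

*ₚ-cong : ∀ f f′ g g′ → f ≈ₚ f′ → g ≈ₚ g′ → f *ₚ g ≈ₚ f′ *ₚ g′
*ₚ-cong []      f′       g g′ f≈f′ g≈g′ n = sym (≈[]⇒*ₚ≈[] f′ g′ (λ m → sym (f≈f′ m)) n)
*ₚ-cong (a ∷ f) []       g g′ f≈f′ g≈g′ n = ≈[]⇒*ₚ≈[] (a ∷ f) g f≈f′ n
*ₚ-cong (a ∷ f) (b ∷ f′) g g′ f≈f′ g≈g′ n = begin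
  coeff ((a ∷ f) *ₚ g) n
    ≡⟨ coeff-∷-* a f g n ⟩
  a * coeff g n ℤ.+ coeff (0ℤ ∷ f *ₚ g) n
    ≡⟨ cong₂ ℤ._+_ (cong₂ _*_ (f≈f′ 0) (g≈g′ n))
         (shift-cong (f *ₚ g) (f′ *ₚ g′) (*ₚ-cong f f′ g g′ (λ m → f≈f′ (suc m)) g≈g′) n) ⟩
  b * coeff g′ n ℤ.+ coeff (0ℤ ∷ f′ *ₚ g′) n
    ≡⟨ coeff-∷-* b f′ g′ n ⟨
  coeff ((b ∷ f′) *ₚ g′) n ∎
  where open ≡-Reasoning

*ₚ-distribʳ-+ₚ : ∀ h f g → (f +ₚ g) *ₚ h ≈ₚ f *ₚ h +ₚ g *ₚ h
*ₚ-distribʳ-+ₚ h []      g       n = refl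
*ₚ-distribʳ-+ₚ h (a ∷ f) []      n = sym (+ₚ-comm ((a ∷ f) *ₚ h) [] n)
*ₚ-distribʳ-+ₚ h (a ∷ f) (b ∷ g) n = begin
  coeff ((a ℤ.+ b ∷ f +ₚ g) *ₚ h) n
    ≡⟨ coeff-∷-* (a ℤ.+ b) (f +ₚ g) h n ⟩
  (a ℤ.+ b) * coeff h n ℤ.+ coeff (0ℤ ∷ (f +ₚ g) *ₚ h) n
    ≡⟨ cong (λ c → (a ℤ.+ b) * coeff h n ℤ.+ c)
         (trans (shift-cong ((f +ₚ g) *ₚ h) (f *ₚ h +ₚ g *ₚ h) (*ₚ-distribʳ-+ₚ h f g) n)
                (coeff-+ₚ (0ℤ ∷ f *ₚ h) (0ℤ ∷ g *ₚ h) n)) ⟩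
  (a ℤ.+ b) * coeff h n ℤ.+ (coeff (0ℤ ∷ f *ₚ h) n ℤ.+ coeff (0ℤ ∷ g *ₚ h) n)
    ≡⟨ rearrange a b (coeff h n) _ _ ⟩
  (a * coeff h n ℤ.+ coeff (0ℤ ∷ f *ₚ h) n) ℤ.+ (b * coeff h n ℤ.+ coeff (0ℤ ∷ g *ₚ h) n)
    ≡⟨ cong₂ ℤ._+_ (coeff-∷-* a f h n) (coeff-∷-* b g h n) ⟨
  coeff ((a ∷ f) *ₚ h) n ℤ.+ coeff ((b ∷ g) *ₚ h) n
    ≡⟨ coeff-+ₚ ((a ∷ f) *ₚ h) ((b ∷ g) *ₚ h) n ⟨
  coeff ((a ∷ f) *ₚ h +ₚ (b ∷ g) *ₚ h) n ∎
  where
  open ≡-Reasoning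
  rearrange : ∀ a b c x y →
              (a ℤ.+ b) * c ℤ.+ (x ℤ.+ y) ≡ (a * c ℤ.+ x) ℤ.+ (b * c ℤ.+ y)
  rearrange = solve-∀

*ₚ-distribˡ-+ₚ : ∀ f g h → f *ₚ (g +ₚ h) ≈ₚ f *ₚ g +ₚ f *ₚ h
*ₚ-distribˡ-+ₚ []      g h n = refl
*ₚ-distribˡ-+ₚ (a ∷ f) g h n = begin
  coeff ((a ∷ f) *ₚ (g +ₚ h)) n
    ≡⟨ coeff-∷-* a f (g +ₚ h) n ⟩
  a * coeff (g +ₚ h) n ℤ.+ coeff (0ℤ ∷ f *ₚ (g +ₚ h)) n
    ≡⟨ cong₂ ℤ._+_ (cong (a *_) (coeff-+ₚ g h n))
         (trans (shift-cong (f *ₚ (g +ₚ h)) (f *ₚ g +ₚ f *ₚ h) (*ₚ-distribˡ-+ₚ f g h) n)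
                (coeff-+ₚ (0ℤ ∷ f *ₚ g) (0ℤ ∷ f *ₚ h) n)) ⟩
  a * (coeff g n ℤ.+ coeff h n) ℤ.+ (coeff (0ℤ ∷ f *ₚ g) n ℤ.+ coeff (0ℤ ∷ f *ₚ h) n)
    ≡⟨ rearrange a (coeff g n) (coeff h n) _ _ ⟩
  (a * coeff g n ℤ.+ coeff (0ℤ ∷ f *ₚ g) n) ℤ.+ (a * coeff h n ℤ.+ coeff (0ℤ ∷ f *ₚ h) n)
    ≡⟨ cong₂ ℤ._+_ (coeff-∷-* a f g n) (coeff-∷-* a f h n) ⟨
  coeff ((a ∷ f) *ₚ g) n ℤ.+ coeff ((a ∷ f) *ₚ h) n
    ≡⟨ coeff-+ₚ ((a ∷ f) *ₚ g) ((a ∷ f) *ₚ h) n ⟨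
  coeff ((a ∷ f) *ₚ g +ₚ (a ∷ f) *ₚ h) n ∎
  where
  open ≡-Reasoning
  rearrange : ∀ a b c x y →
              a * (b ℤ.+ c) ℤ.+ (x ℤ.+ y) ≡ (a * b ℤ.+ x) ℤ.+ (a * c ℤ.+ y)
  rearrange = solve-∀

scale-*ₚ : ∀ a f g → map (a *_) f *ₚ g ≈ₚ map (a *_) (f *ₚ g)
scale-*ₚ a []      g n = refl
scale-*ₚ a (b ∷ f) g n = begin
  coeff ((a * b ∷ map (a *_) f) *ₚ g) n
    ≡⟨ coeff-∷-* (a * b) (map (a *_) f) g n ⟩
  a * b * coeff g n ℤ.+ coeff (0ℤ ∷ map (a *_) f *ₚ g) n
    ≡⟨ cong₂ ℤ._+_ (ℤ.*-assoc a b _) (tail n) ⟩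
  a * (b * coeff g n) ℤ.+ a * coeff (0ℤ ∷ f *ₚ g) n
    ≡⟨ ℤ.*-distribˡ-+ a (b * coeff g n) _ ⟨
  a * (b * coeff g n ℤ.+ coeff (0ℤ ∷ f *ₚ g) n)
    ≡⟨ cong (a *_) (coeff-∷-* b f g n) ⟨
  a * coeff ((b ∷ f) *ₚ g) n
    ≡⟨ coeff-scale a ((b ∷ f) *ₚ g) n ⟨
  coeff (map (a *_) ((b ∷ f) *ₚ g)) n ∎
  where
  open ≡-Reasoning
  tail : ∀ n → coeff (0ℤ ∷ map (a *_) f *ₚ g) n ≡ a * coeff (0ℤ ∷ f *ₚ g) n
  tail zero    = sym (ℤ.*-zeroʳ a)
  tail (suc n) = trans (scale-*ₚ a f g n) (coeff-scale a (f *ₚ g) n)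

shift-*ₚ : ∀ f g → (0ℤ ∷ f) *ₚ g ≈ₚ 0ℤ ∷ f *ₚ g
shift-*ₚ f g n = trans (coeff-∷-* 0ℤ f g n) (ℤ.+-identityˡ _)

-- Write the left factor as a + λf and distribute h over ag + λ(fg): scaling by a and multiplication
-- by λ both commute with right multiplication by h, and induction handles (fg)h.
*ₚ-assoc : ∀ f g h → (f *ₚ g) *ₚ h ≈ₚ f *ₚ (g *ₚ h)
*ₚ-assoc []      g h n = refl
*ₚ-assoc (a ∷ f) g h n = begin
  coeff ((map (a *_) g +ₚ (0ℤ ∷ f *ₚ g)) *ₚ h) n
    ≡⟨ *ₚ-distribʳ-+ₚ h (map (a *_) g) (0ℤ ∷ f *ₚ g) n ⟩
  coeff (map (a *_) g *ₚ h +ₚ (0ℤ ∷ f *ₚ g) *ₚ h) n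
    ≡⟨ +ₚ-cong (map (a *_) g *ₚ h) (map (a *_) (g *ₚ h))
               ((0ℤ ∷ f *ₚ g) *ₚ h) (0ℤ ∷ f *ₚ (g *ₚ h))
               (scale-*ₚ a g h)
               (λ m → trans (shift-*ₚ (f *ₚ g) h m)
                            (shift-cong ((f *ₚ g) *ₚ h) (f *ₚ (g *ₚ h)) (*ₚ-assoc f g h) m)) n ⟩
  coeff ((a ∷ f) *ₚ (g *ₚ h)) n ∎
  where open ≡-Reasoning

*ₚ-identityˡ : ∀ f → const 1ℤ *ₚ f ≈ₚ f
*ₚ-identityˡ f n = begin
  coeff (const 1ℤ *ₚ f) n             ≡⟨ coeff-∷-* 1ℤ [] f n ⟩
  1ℤ * coeff f n ℤ.+ coeff (0ℤ ∷ []) n ≡⟨ cong₂ ℤ._+_ (ℤ.*-identityˡ (coeff f n)) (tail n) ⟩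
  coeff f n ℤ.+ 0ℤ                    ≡⟨ ℤ.+-identityʳ _ ⟩
  coeff f n                           ∎
  where
  open ≡-Reasoning
  tail : 0ℤ ∷ [] ≈ₚ []
  tail zero    = refl
  tail (suc n) = refl

*ₚ-identityʳ : ∀ f → f *ₚ const 1ℤ ≈ₚ f
*ₚ-identityʳ []      n       = refl
*ₚ-identityʳ (a ∷ f) zero    = trans (ℤ.+-identityʳ _) (ℤ.*-identityʳ a)
*ₚ-identityʳ (a ∷ f) (suc n) = *ₚ-identityʳ f n

ℤ[λ]-isRing : IsRing _≈ₚ_ _+ₚ_ _*ₚ_ (λ f → -ₚ f) [] (const 1ℤ)
ℤ[λ]-isRing = record
  { +-isAbelianGroup = +ₚ-isAbelianGroup
  ; *-cong           = λ {f} {f′} {g} {g′} → *ₚ-cong f f′ g g′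
  ; *-assoc          = *ₚ-assoc
  ; *-identity       = *ₚ-identityˡ , *ₚ-identityʳ
  ; distrib          = *ₚ-distribˡ-+ₚ , *ₚ-distribʳ-+ₚ
  }

ℤ[λ]-ring : Ring 0ℓ 0ℓ
ℤ[λ]-ring = record { isRing = ℤ[λ]-isRing }

-- The matrices K - λI and the recurrence.

open LinearAlgebra ℤ[λ] using (det; identity)
open Determinant ℤ[λ]-ring using (IsToeplitzHessenberg; det-recurrence)
open import Algebra.Definitions.RawSemiring (RawRing.rawSemiring ℤ[λ])
  using () renaming (_^_ to _^ₚ_)
open SemiringSum (Ring.semiring ℤ[λ]-ring) using (sum; sum-cong-≋)

const-*ₚ : ∀ a b → const a *ₚ const b ≈ₚ const (a * b)
const-*ₚ a b zero    = ℤ.+-identityʳ _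
const-*ₚ a b (suc n) = refl

-- The signs of the cofactor expansion are powers in ℤ[λ], while those of the theorem are integer
-- powers under `const`; this converts one into the other.
const-^ₚ : ∀ a n → const a ^ₚ n ≈ₚ const (a ^ n)
const-^ₚ a zero    m = refl
const-^ₚ a (suc n) m = trans
  (*ₚ-cong (const a) (const a) (const a ^ₚ n) (const (a ^ n)) (λ _ → refl) (const-^ₚ a n) m)
  (const-*ₚ a (a ^ n) m)

K-λI : ℕ → (r : ℕ) → Matrix Poly r r
K-λI k r p q = const (K k r p q) -ₚ X *ₚ identity p q

-- `kPoly` is defined by cases on the size, so it unfolds only after a split; at size 0 the empty
-- determinant agrees with the convention k₀ = 1.
kPoly≡det : ∀ k r → kPoly k r ≡ det (K-λI k r)
kPoly≡det k zero    = refl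
kPoly≡det k (suc r) = refl

-- The entries depend only on q - p. Splitting the row index lets the comparison `≤?` compute on
-- both sides.
K-translate : ∀ k {r} (p q : Fin r) → K k (suc r) (Fin.suc p) (Fin.suc q) ≡ K k r p q
K-translate k Fin.zero    q = refl
K-translate k (Fin.suc p) q = refl

-- Off the diagonal `identity` gives `[]`, but `X *ₚ []` computes to a list of two zeros, so the
-- entry is the constant only up to a trailing zero.
K-λI-offDiagonal : ∀ a → const a -ₚ X *ₚ [] ≈ₚ const a
K-λI-offDiagonal a zero          = ℤ.+-identityʳ a
K-λI-offDiagonal a (suc zero)    = refl
K-λI-offDiagonal a (suc (suc n)) = refl

K-λI-isToeplitzHessenberg : ∀ k → IsToeplitzHessenberg (K-λI k)
K-λI-isToeplitzHessenberg k = record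
  -- `identity` is translation invariant by computation, which leaves only the entry of `K` to
  -- rewrite.
  { translate   = λ p q n → cong (λ a → coeff (const a -ₚ X *ₚ identity p q) n) (K-translate k p q)
  ; subdiagonal = K-λI-offDiagonal 1ℤ
  ; below       = λ { p zero → refl ; p (suc zero) → refl ; p (suc (suc n)) → refl }
  }

-- Matches the term of column j + 1 in the expansion with the summand i = j + 2 of the theorem,
-- where k = k′ + 3. The upper binomial arguments agree, as (k - 2) + (j + 1) = k + i - 3, and the
-- signs agree because the exponents j + 1 and i + 1 differ by 2.
superdiagonal-term : ∀ k′ j f →
  (-ₚ const 1ℤ) ^ₚ suc j *ₚ
    ((const (+ ((suc k′ + suc j) C k′)) -ₚ X *ₚ []) *ₚ f)
  ≈ₚ const (-1ℤ ^ (2 + j + 1) * + ((3 + k′ + (2 + j) ∸ 3) C k′)) *ₚ f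
superdiagonal-term k′ j f = begin
  -- `-ₚ const 1ℤ` computes to `const -1ℤ`.
  const -1ℤ ^ₚ suc j *ₚ ((const c -ₚ X *ₚ []) *ₚ f)
    ≈⟨ *ₚ-cong (const -1ℤ ^ₚ suc j) (const (-1ℤ ^ suc j))
               ((const c -ₚ X *ₚ []) *ₚ f) (const c *ₚ f)
               (const-^ₚ -1ℤ (suc j))
               (*ₚ-cong (const c -ₚ X *ₚ []) (const c) f f (K-λI-offDiagonal c) (λ _ → refl)) ⟩
  const (-1ℤ ^ suc j) *ₚ (const c *ₚ f)
    ≈⟨ *ₚ-assoc (const (-1ℤ ^ suc j)) (const c) f ⟨
  (const (-1ℤ ^ suc j) *ₚ const c) *ₚ f
    ≈⟨ *ₚ-cong (const (-1ℤ ^ suc j) *ₚ const c) (const (-1ℤ ^ suc j * c)) f f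
               (const-*ₚ (-1ℤ ^ suc j) c) (λ _ → refl) ⟩
  const (-1ℤ ^ suc j * c) *ₚ f
    ≡⟨ cong₂ (λ s m → const (s * + (m C k′)) *ₚ f) sign (sym (ℕ.+-suc k′ (suc j))) ⟩
  const (-1ℤ ^ (2 + j + 1) * + ((k′ + (2 + j)) C k′)) *ₚ f ∎
  where
  open SetoidReasoning (Ring.setoid ℤ[λ]-ring)
  c : ℤ
  c = + ((suc k′ + suc j) C k′)
  sign : -1ℤ ^ suc j ≡ -1ℤ ^ (2 + j + 1)
  sign = trans (cong (-1ℤ ^_) (ℕ.+-comm 1 j))
    -- The inserted factor 1 is, by computation, the product of two factors -1.
    (trans (sym (ℤ.*-identityˡ _)) (ℤ.*-assoc -1ℤ -1ℤ (-1ℤ ^ (j + 1))))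

corollary1 : ∀ (k : ℕ) → 3 ≤ k → ∀ (r : ℕ) → 1 ≤ r →
    kPoly k r ≈ₚ
    (const (+ ((k ∸ 2) C (k ∸ 3))) -ₚ X) *ₚ kPoly k (r ∸ 1)
    +ₚ sumFromTo 2 r (λ i → const (-1ℤ ^ (i + 1) * + ((k + i ∸ 3) C (k ∸ 3))) *ₚ kPoly k (r ∸ i))
corollary1 k@(suc (suc (suc k′))) (s≤s (s≤s (s≤s z≤n))) (suc n) _ = begin
  det (K-λI k (suc n))
    ≈⟨ det-recurrence (K-λI-isToeplitzHessenberg k) n ⟩
  (const (+ ((suc k′ + 0) C k′)) -ₚ X) *ₚ det (K-λI k n) +ₚ sum (λ j → term j (det (K-λI k (n ∸ suc (toℕ j)))))
    -- On the diagonal q - p = 0 leaves a `+ 0` in the binomial, and `X *ₚ const 1ℤ` has already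
    -- computed to `X`.
    ≡⟨ cong₂ (λ m f → (const (+ (m C k′)) -ₚ X) *ₚ f +ₚ sum (λ j → term j (det (K-λI k (n ∸ suc (toℕ j))))))
             (ℕ.+-identityʳ (suc k′)) (sym (kPoly≡det k n)) ⟩
  head +ₚ sum (λ j → term j (det (K-λI k (n ∸ suc (toℕ j)))))
    ≈⟨ +ₚ-cong head head _ (sum summand) (λ _ → refl) (sum-cong-≋ {n} {_} {summand} step) ⟩
  -- The range from 2 to n + 1 has n terms, none when r = 1. With i = j + 2 the index `suc n ∸ i`
  -- computes to `n ∸ suc j`, so this sum is the `sumFromTo` of the theorem by computation.
  head +ₚ sum summand ∎
  where
  open SetoidReasoning (Ring.setoid ℤ[λ]-ring)
  head : Poly
  head = (const (+ (suc k′ C k′)) -ₚ X) *ₚ kPoly k n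
  term : Fin n → Poly → Poly
  term j f = (-ₚ const 1ℤ) ^ₚ suc (toℕ j) *ₚ
    ((const (+ ((suc k′ + suc (toℕ j)) C k′)) -ₚ X *ₚ []) *ₚ f)
  summand : Fin n → Poly
  summand j = const (-1ℤ ^ (2 + toℕ j + 1) * + ((k + (2 + toℕ j) ∸ 3) C k′)) *ₚ kPoly k (suc n ∸ (2 + toℕ j))
  step : ∀ j → term j (det (K-λI k (n ∸ suc (toℕ j)))) ≈ₚ summand j
  step j m = trans
    (cong (λ f → coeff (term j f) m) (sym (kPoly≡det k (n ∸ suc (toℕ j)))))
    (superdiagonal-term k′ (toℕ j) (kPoly k (n ∸ suc (toℕ j))) m)
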